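{- Let $X\subseteq\mathbb{Z}^2\setminus\{O\}$ be a step set, let $\mathcal{C}$ be a submonoid of $\mathbb{Z}^2$, and let $Y\subseteq X$ be the set of $(X,\mathcal{C})$-admissible steps. If $Y$ is finite, then the following are equivalent: (i) $(X,\mathcal{C})$ has the Finite Paths Property (FPP); (ii) $O\notin\operatorname{Conv}(Y)$; (iii) $Y$ satisfies the Line Condition (LC).
   Context: Write $O=(0,0)$. A step set is any (finite or infinite) subset $X$ of $\mathbb{Z}^2\setminus\{O\}$. $\mathcal{F}_X$ is the free monoid on $X$ (all finite words over $X$, including the empty word), with $\ell(w)$ the length of $w$; for $w=A_1\cdots A_k\in\mathcal{F}_X$ put $\alpha_X(w)=A_1+\cdots+A_k$ and, for $0\le m\le k$, $\sigma_m(w)=A_1\cdots A_m$. For a submonoid $\mathcal{C}$ of $\mathbb{Z}^2$, define $\mathcal{F}_X^{\mathcal{C}}=\{w\in\mathcal{F}_X:\alpha_X(\sigma_m(w))\in\mathcal{C}\text{ for all }0\le m\le\ell(w)\}$ and $\mathcal{A}_X^{\mathcal{C}}=\alpha_X(\mathcal{F}_X^{\mathcal{C}})$. For $A\in\mathbb{Z}^2$, $\pi_X^{\mathcal{C}}(A)$ is the (possibly infinite) number of $w\in\mathcal{F}_X^{\mathcal{C}}$ with $\alpha_X(w)=A$. $(X,\mathcal{C})$ has the FPP if $\pi_X^{\mathcal{C}}(A)<\infty$ for all $A\in\mathcal{A}_X^{\mathcal{C}}$. A step $A\in X$ is $(X,\mathcal{C})$-admissible if there exist words $u,v\in\mathcal{F}_X$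 such that $uAv\in\mathcal{F}_X^{\mathcal{C}}$. A step set satisfies the LC if it is contained in an open half-plane of $\mathbb{R}^2$ bounded by a line through $O$. $\operatorname{Conv}$ denotes convex hull in $\mathbb{R}^2$. -}

module Defs where

open import Algebra.Bundles.Raw using (RawMonoid)
open import Algebra.Definitions.RawMonoid using (sum)
open import Data.Fin.Base using (Fin)
open import Data.Integer.Base as ℤ using (ℤ; 0ℤ)
open import Data.List.Base using (List; []; _∷_; _++_; foldr; length; take)
open import Data.List.Membership.Propositional using () renaming (_∈_ to _∈ₗ_)
open import Data.List.Relation.Unary.All using (All)
open import Data.List.Relation.Unary.Unique.Propositional using (Unique)
open import Data.Nat.Base as ℕ using (ℕ)
import Data.Nat.Properties as ℕ
open import Data.Product.Base using (∃; ∃₂; _×_; _,_; proj₁; proj₂; zip)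
open import Data.Rational.Base as ℚ using (ℚ; 0ℚ; 1ℚ; ½; Positive; ∣_∣; _<_; _≤_; _/_)
import Data.Rational.Properties as ℚ
open import Data.Rational.Solver using (module +-*-Solver)
open import Function.Bundles using (_⇔_)
open import Level using (Level; 0ℓ; _⊔_)
open import Relation.Binary.PropositionalEquality
  using (_≡_; refl; sym; cong; subst; module ≡-Reasoning)
open import Relation.Nullary using (¬_)
open import Relation.Unary using (Pred; _∈_; _∉_; _⊆_)

private
  variable
    a c ℓ : Level

-- The reals are Cauchy sequences of rationals, equality being the
-- equivalence relation _≈ᵣ_.

IsCauchy : (ℕ → ℚ) → Set
IsCauchy s = ∀ ε → 0ℚ < ε →
  ∃ λ N → ∀ m n → N ℕ.≤ m → N ℕ.≤ n → ∣ s m ℚ.- s n ∣ < ε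

record ℝ : Set where
  constructor mkℝ
  field
    seq    : ℕ → ℚ
    cauchy : IsCauchy seq

open ℝ public

infix  4 _≈ᵣ_ _<ᵣ_ _≤ᵣ_
infixl 6 _+ᵣ_
infixl 7 _*ᵣ_

_≈ᵣ_ : ℝ → ℝ → Set
x ≈ᵣ y = ∀ ε → 0ℚ < ε →
  ∃ λ N → ∀ n → N ℕ.≤ n → ∣ seq x n ℚ.- seq y n ∣ < ε

-- The uniform gap ε is what makes this the strict order of the limits
-- and not merely of the terms.
_<ᵣ_ : ℝ → ℝ → Set
x <ᵣ y = ∃ λ ε → 0ℚ < ε ×
  ∃ λ N → ∀ n → N ℕ.≤ n → seq x n ℚ.+ ε ≤ seq y n

_≤ᵣ_ : ℝ → ℝ → Set
x ≤ᵣ y = ∀ ε → 0ℚ < ε →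
  ∃ λ N → ∀ n → N ℕ.≤ n → seq x n ≤ seq y n ℚ.+ ε

half>0 : ∀ {ε} → 0ℚ < ε → 0ℚ < ½ ℚ.* ε
half>0 {ε} 0<ε = subst (_< ½ ℚ.* ε) (ℚ.*-zeroʳ ½) (ℚ.*-monoʳ-<-pos ½ 0<ε)

halves : ∀ ε → ½ ℚ.* ε ℚ.+ ½ ℚ.* ε ≡ ε
halves = solve 1 (λ e → con ½ :* e :+ con ½ :* e := e) refl
  where open +-*-Solver

triangle : ∀ ε {p q r} → p ℚ.+ q ≡ r →
           ∣ p ∣ < ½ ℚ.* ε → ∣ q ∣ < ½ ℚ.* ε → ∣ r ∣ < ε
triangle ε {p} {q} refl p< q< = subst (∣ p ℚ.+ q ∣ <_) (halves ε)
  (ℚ.≤-<-trans (ℚ.∣p+q∣≤∣p∣+∣q∣ p q) (ℚ.+-mono-< p< q<))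

bounded : ∀ {s} → IsCauchy s →
          ∃ λ B → 0ℚ < B × ∃ λ N → ∀ n → N ℕ.≤ n → ∣ s n ∣ ≤ B
bounded {s} cs with cs 1ℚ (ℚ.positive⁻¹ 1ℚ)
... | N , h = 1ℚ ℚ.+ ∣ s N ∣
            , ℚ.<-≤-trans (ℚ.positive⁻¹ 1ℚ)
                (subst (_≤ 1ℚ ℚ.+ ∣ s N ∣) (ℚ.+-identityʳ 1ℚ)
                  (ℚ.+-monoʳ-≤ 1ℚ (ℚ.0≤∣p∣ (s N))))
            , N
            , λ n N≤n → ℚ.≤-trans
                (subst (λ t → ∣ t ∣ ≤ ∣ s n ℚ.- s N ∣ ℚ.+ ∣ s N ∣) (eq (s n) (s N))
                  (ℚ.∣p+q∣≤∣p∣+∣q∣ (s n ℚ.- s N) (s N)))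
                (ℚ.+-monoˡ-≤ ∣ s N ∣ (ℚ.<⇒≤ (h n N N≤n ℕ.≤-refl)))
  where
  eq : ∀ x y → x ℚ.- y ℚ.+ y ≡ x
  eq = solve 2 (λ x y → x :- y :+ y := x) refl
    where open +-*-Solver

scale : ∀ {B ε} → 0ℚ < B → 0ℚ < ε →
        ∃ λ δ → 0ℚ < δ × (∀ p q → ∣ p ∣ ≤ B → ∣ q ∣ < δ → ∣ p ℚ.* q ∣ < ε)
scale {B} {ε} 0<B 0<ε = δ , 0<δ , bound
  where
  instance
    B-pos : Positive B
    B-pos = ℚ.positive 0<B
    B-nonZero : ℚ.NonZero B
    B-nonZero = ℚ.pos⇒nonZero B
    B⁻¹-pos : Positive (ℚ.1/ B)
    B⁻¹-pos = ℚ.1/pos⇒pos B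
  δ : ℚ
  δ = ℚ.1/ B ℚ.* ε
  0<δ : 0ℚ < δ
  0<δ = subst (_< δ) (ℚ.*-zeroʳ (ℚ.1/ B)) (ℚ.*-monoʳ-<-pos (ℚ.1/ B) 0<ε)
  Bδ≡ε : B ℚ.* δ ≡ ε
  Bδ≡ε = begin
    B ℚ.* (ℚ.1/ B ℚ.* ε)   ≡⟨ ℚ.*-assoc B (ℚ.1/ B) ε ⟨
    (B ℚ.* ℚ.1/ B) ℚ.* ε   ≡⟨ cong (ℚ._* ε) (ℚ.*-inverseʳ B) ⟩
    1ℚ ℚ.* ε               ≡⟨ ℚ.*-identityˡ ε ⟩
    ε                      ∎
    where open ≡-Reasoning
  bound : ∀ p q → ∣ p ∣ ≤ B → ∣ q ∣ < δ → ∣ p ℚ.* q ∣ < ε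
  bound p q p≤ q< rewrite ℚ.∣p*q∣≡∣p∣*∣q∣ p q = ℚ.≤-<-trans
    (ℚ.*-monoʳ-≤-nonNeg ∣ q ∣ {{ℚ.∣-∣-nonNeg q}} p≤)
    (subst (B ℚ.* ∣ q ∣ <_) Bδ≡ε (ℚ.*-monoʳ-<-pos B q<))

const-cauchy : ∀ q → IsCauchy (λ _ → q)
const-cauchy q ε 0<ε = 0 , λ _ _ _ _ →
  subst (_< ε) (cong ∣_∣ (sym (ℚ.+-inverseʳ q))) 0<ε

+-cauchy : ∀ {s t} → IsCauchy s → IsCauchy t → IsCauchy (λ n → s n ℚ.+ t n)
+-cauchy {s} {t} cs ct ε 0<ε with cs (½ ℚ.* ε) (half>0 0<ε) | ct (½ ℚ.* ε) (half>0 0<ε)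
... | N , f | M , g = N ℕ.⊔ M , λ m n m≥ n≥ →
    triangle ε (eq (s m) (s n) (t m) (t n))
      (f m n (ℕ.m⊔n≤o⇒m≤o N M m≥) (ℕ.m⊔n≤o⇒m≤o N M n≥))
      (g m n (ℕ.m⊔n≤o⇒n≤o N M m≥) (ℕ.m⊔n≤o⇒n≤o N M n≥))
  where
  eq : ∀ a c b d → (a ℚ.- c) ℚ.+ (b ℚ.- d) ≡ (a ℚ.+ b) ℚ.- (c ℚ.+ d)
  eq = solve 4 (λ a c b d → (a :- c) :+ (b :- d) := (a :+ b) :- (c :+ d)) refl
    where open +-*-Solver

product-close : ∀ ε {p q p′ q′} → ∣ p ℚ.* (q ℚ.- q′) ∣ < ½ ℚ.* ε →
                ∣ q′ ℚ.* (p ℚ.- p′) ∣ < ½ ℚ.* ε → ∣ p ℚ.* q ℚ.- p′ ℚ.* q′ ∣ < ε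
product-close ε {p} {q} {p′} {q′} = triangle ε (eq p p′ q q′)
  where
  eq : ∀ a c b d → a ℚ.* (b ℚ.- d) ℚ.+ d ℚ.* (a ℚ.- c) ≡ a ℚ.* b ℚ.- c ℚ.* d
  eq = solve 4 (λ a c b d → a :* (b :- d) :+ d :* (a :- c) := a :* b :- c :* d) refl
    where open +-*-Solver

*-cauchy : ∀ {s t} → IsCauchy s → IsCauchy t → IsCauchy (λ n → s n ℚ.* t n)
*-cauchy {s} {t} cs ct ε 0<ε = go (bounded cs) (bounded ct)
  where
  go : ∃ (λ B → 0ℚ < B × ∃ λ N → ∀ n → N ℕ.≤ n → ∣ s n ∣ ≤ B) →
       ∃ (λ D → 0ℚ < D × ∃ λ N → ∀ n → N ℕ.≤ n → ∣ t n ∣ ≤ D) →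
       ∃ λ N → ∀ m n → N ℕ.≤ m → N ℕ.≤ n → ∣ s m ℚ.* t m ℚ.- s n ℚ.* t n ∣ < ε
  go (B , 0<B , K , s≤B) (D , 0<D , L , t≤D) =
    (K ℕ.⊔ L) ℕ.⊔ (M ℕ.⊔ N) , λ m n m≥ n≥ →
      let m≥₁ = ℕ.m⊔n≤o⇒m≤o (K ℕ.⊔ L) (M ℕ.⊔ N) m≥
          m≥₂ = ℕ.m⊔n≤o⇒n≤o (K ℕ.⊔ L) (M ℕ.⊔ N) m≥
          n≥₁ = ℕ.m⊔n≤o⇒m≤o (K ℕ.⊔ L) (M ℕ.⊔ N) n≥
          n≥₂ = ℕ.m⊔n≤o⇒n≤o (K ℕ.⊔ L) (M ℕ.⊔ N) n≥
      in product-close ε {s m} {t m} {s n} {t n}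
           (proj₂ (proj₂ δ) (s m) (t m ℚ.- t n) (s≤B m (ℕ.m⊔n≤o⇒m≤o K L m≥₁))
             (proj₂ t-close m n (ℕ.m⊔n≤o⇒m≤o M N m≥₂) (ℕ.m⊔n≤o⇒m≤o M N n≥₂)))
           (proj₂ (proj₂ η) (t n) (s m ℚ.- s n) (t≤D n (ℕ.m⊔n≤o⇒n≤o K L n≥₁))
             (proj₂ s-close m n (ℕ.m⊔n≤o⇒n≤o M N m≥₂) (ℕ.m⊔n≤o⇒n≤o M N n≥₂)))
    where
    δ = scale 0<B (half>0 0<ε)
    η = scale 0<D (half>0 0<ε)
    t-close = ct (proj₁ δ) (proj₁ (proj₂ δ))
    s-close = cs (proj₁ η) (proj₁ (proj₂ η))
    M = proj₁ t-close
    N = proj₁ s-close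

fromℚ : ℚ → ℝ
fromℚ q = mkℝ (λ _ → q) (const-cauchy q)

fromℤ : ℤ → ℝ
fromℤ i = fromℚ (i / 1)

0ᵣ 1ᵣ : ℝ
0ᵣ = fromℚ 0ℚ
1ᵣ = fromℚ 1ℚ

_+ᵣ_ _*ᵣ_ : ℝ → ℝ → ℝ
x +ᵣ y = mkℝ (λ n → seq x n ℚ.+ seq y n)
  (+-cauchy {seq x} {seq y} (cauchy x) (cauchy y))
x *ᵣ y = mkℝ (λ n → seq x n ℚ.* seq y n)
  (*-cauchy {seq x} {seq y} (cauchy x) (cauchy y))

+ᵣ-rawMonoid : RawMonoid 0ℓ 0ℓ
+ᵣ-rawMonoid = record { Carrier = ℝ ; _≈_ = _≈ᵣ_ ; _∙_ = _+ᵣ_ ; ε = 0ᵣ }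

Σᵣ : ∀ {n} → (Fin n → ℝ) → ℝ
Σᵣ = sum +ᵣ-rawMonoid

ℝ² : Set
ℝ² = ℝ × ℝ

infix 4 _≈²_

_≈²_ : ℝ² → ℝ² → Set
(x , y) ≈² (x′ , y′) = x ≈ᵣ x′ × y ≈ᵣ y′

0² : ℝ²
0² = 0ᵣ , 0ᵣ

Conv : Pred ℝ² ℓ → Pred ℝ² ℓ
Conv S q = ∃ λ n → ∃₂ λ (w : Fin n → ℝ) (p : Fin n → ℝ²) →
  (∀ i → p i ∈ S) ×
  (∀ i → 0ᵣ ≤ᵣ w i) ×
  Σᵣ w ≈ᵣ 1ᵣ ×
  (Σᵣ (λ i → w i *ᵣ proj₁ (p i)) , Σᵣ (λ i → w i *ᵣ proj₂ (p i))) ≈² q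

-- Bounded by the line through the origin with normal (u , v); a
-- half-plane only if this normal is nonzero.
OpenHalfPlane : ℝ² → Pred ℝ² 0ℓ
OpenHalfPlane (u , v) (x , y) = 0ᵣ <ᵣ u *ᵣ x +ᵣ v *ᵣ y

ℤ² : Set
ℤ² = ℤ × ℤ

O : ℤ²
O = 0ℤ , 0ℤ

infixl 6 _⊕_

_⊕_ : ℤ² → ℤ² → ℤ²
_⊕_ = zip ℤ._+_ ℤ._+_

ι : ℤ² → ℝ²
ι (i , j) = fromℤ i , fromℤ j

ι[_] : Pred ℤ² ℓ → Pred ℝ² ℓ
ι[ S ] p = ∃ λ A → A ∈ S × p ≈² ι A

record IsSubmonoid (C : Pred ℤ² c) : Set c where
  field
    O∈       : O ∈ C
    ⊕-closed : ∀ {A B} → A ∈ C → B ∈ C → (A ⊕ B) ∈ C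

-- S is the set of entries of some list; constructively stronger than being
-- contained in one.
Finite : Pred ℤ² ℓ → Set ℓ
Finite S = ∃ λ (As : List ℤ²) → ∀ A → A ∈ S ⇔ A ∈ₗ As

LC : Pred ℤ² ℓ → Set ℓ
LC S = ∃ λ (u : ℝ²) → ¬ (u ≈² 0²) × ι[ S ] ⊆ OpenHalfPlane u

-- A word over X is a list of points all of whose entries lie in X: pairing
-- each letter with its membership proof would distinguish words by those
-- proofs.
Word : Set
Word = List ℤ²

𝓕 : Pred ℤ² a → Pred Word a
𝓕 X = All X

α : Word → ℤ²
α = foldr _⊕_ O

σ : ℕ → Word → Word
σ = take

𝓕[_,_] : Pred ℤ² a → Pred ℤ² c → Pred Word (a ⊔ c)
𝓕[ X , C ] w = w ∈ 𝓕 X × (∀ m → m ℕ.≤ length w → α (σ m w) ∈ C)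

Path : Pred ℤ² a → Pred ℤ² c → ℤ² → Pred Word (a ⊔ c)
Path X C A w = w ∈ 𝓕[ X , C ] × α w ≡ A

𝓐[_,_] : Pred ℤ² a → Pred ℤ² c → Pred ℤ² (a ⊔ c)
𝓐[ X , C ] A = ∃ (Path X C A)

-- The number of paths to A is at most n, that is, n bounds the size of
-- every list of distinct paths to A.  Since C need not be decidable, the
-- number itself is not constructively available in ℕ or ℕ ∪ {∞}.
π[_,_]_≤_ : Pred ℤ² a → Pred ℤ² c → ℤ² → ℕ → Set (a ⊔ c)
π[ X , C ] A ≤ n =
  ∀ (ws : List Word) → Unique ws → All (Path X C A) ws → length ws ℕ.≤ n

FPP : Pred ℤ² a → Pred ℤ² c → Set (a ⊔ c)
FPP X C = ∀ A → A ∈ 𝓐[ X , C ] → ∃ λ n → π[ X , C ] A ≤ n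

Admissible : Pred ℤ² a → Pred ℤ² c → Pred ℤ² (a ⊔ c)
Admissible X C A = A ∈ X ×
  ∃₂ λ u v → u ∈ 𝓕 X × v ∈ 𝓕 X × (u ++ A ∷ v) ∈ 𝓕[ X , C ]

{-# OPTIONS --safe #-}
module Submission where

-- Everything follows from Gordan's alternative for a finite list of integer
-- vectors: either some integer functional u is positive on all of them, or some
-- nonempty sequence of them has sum O. The alternative is proved by induction on
-- the list: if u is positive on As but not on B, then either As lies strictly on
-- one side of the line through B, and a functional that vanishes on B can be
-- tilted towards B, or B and at most two vectors of As have a vanishing
-- nonnegative combination.
--
-- If u exists, all three properties hold: the half-plane of u contains the steps
-- and excludes O from their convex hull, and a path to A has at most u·A steps,
-- all of them admissible. If a sequence B₁⋯Bₖ of admissible steps has sum O, all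
-- three fail: u·Bᵢ > 0 would add up to u·O > 0, the uniform weights 1/k put O into
-- the convex hull, and, when uᵢBᵢ is the beginning of a path witnessing that Bᵢ is
-- admissible, the words u₁⋯uₖ(B₁⋯Bₖ)ⁿ are infinitely many paths to one point.

open import Defs
import Algebra.Properties.CommutativeMonoid.Sum as Sum
open import Data.Empty using (⊥-elim)
open import Data.Fin.Base using (Fin; zero; suc)
open import Data.Fin.Properties using (injective⇒≤)
open import Data.Integer.Base as ℤ using (ℤ; 0ℤ; 1ℤ; +_; +[1+_]; -[1+_])
import Data.Integer.Properties as ℤ
open import Data.Integer.Tactic.RingSolver using (solve-∀)
open import Data.List.Base
  using (List; []; _∷_; [_]; _++_; replicate; length; lookup; applyUpTo; cartesianProductWith; concat)
open import Data.List.Membership.Propositional using (find) renaming (_∈_ to _∈ₗ_)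
open import Data.List.Membership.Propositional.Properties using (∈-∃++; ∈-cartesianProductWith⁺; ∈-lookup)
import Data.List.Membership.Setoid.Properties as Membershipₛ
import Data.List.Properties as List
open import Data.List.Relation.Unary.All as All using (All; []; _∷_)
import Data.List.Relation.Unary.All.Properties as All
open import Data.List.Relation.Unary.AllPairs.Core using (_∷_)
open import Data.List.Relation.Unary.Any using (here; there; index)
open import Data.List.Relation.Unary.Unique.Propositional using (Unique)
import Data.List.Relation.Unary.Unique.Propositional.Properties as Unique
open import Data.Nat.Base as ℕ using (ℕ; zero; suc; z≤n; s≤s)
import Data.Nat.Properties as ℕ
open import Data.Product.Base using (∃; ∃₂; _×_; _,_; proj₁; proj₂)
open import Data.Product.Properties using (≡-dec)
open import Data.Rational.Base as ℚ
  using (ℚ; 0ℚ; 1ℚ; ½; ∣_∣; _/_; _+_; _*_; _-_; -_; _<_; _≤_; toℚᵘ)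
import Data.Rational.Properties as ℚ
import Data.Rational.Solver as ℚ-Solver
open import Data.Rational.Unnormalised.Base as ℚᵘ using (mkℚᵘ; _≃_; *≡*; *≤*)
import Data.Rational.Unnormalised.Properties as ℚᵘ
open import Data.Sum.Base using (_⊎_; inj₁; inj₂; [_,_]′)
open import Function.Base using (_∘_)
open import Function.Bundles using (_⇔_; mk⇔; Equivalence)
open import Level using (Level)
open import Relation.Binary.Definitions using (tri<; tri≈; tri>)
open import Relation.Binary.PropositionalEquality
  using (_≡_; refl; sym; trans; cong; cong₂; subst; subst₂; setoid; module ≡-Reasoning)
open import Relation.Nullary using (¬_; yes; no)
open import Relation.Unary using (Pred; _∈_; _∉_)

open import Algebra.Properties.Group ℚ.+-0-group using () renaming (⁻¹-involutive to neg-involutive)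
open Sum ℚ.+-0-commutativeMonoid using (sum; sum-cong-≗)

private
  variable
    a c ℓ : Level
    X : Pred ℤ² a
    C : Pred ℤ² c
    As : List ℤ²

-- Addition of lattice points and sums of words.

⊕-identityˡ : ∀ A → O ⊕ A ≡ A
⊕-identityˡ (x , y) = cong₂ _,_ (ℤ.+-identityˡ x) (ℤ.+-identityˡ y)

⊕-identityʳ : ∀ A → A ⊕ O ≡ A
⊕-identityʳ (x , y) = cong₂ _,_ (ℤ.+-identityʳ x) (ℤ.+-identityʳ y)

⊕-assoc : ∀ A B D → (A ⊕ B) ⊕ D ≡ A ⊕ (B ⊕ D)
⊕-assoc (x , y) (x′ , y′) (x″ , y″) = cong₂ _,_ (ℤ.+-assoc x x′ x″) (ℤ.+-assoc y y′ y″)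

⊕-interchange : ∀ A B D E → (A ⊕ B) ⊕ (D ⊕ E) ≡ (A ⊕ D) ⊕ (B ⊕ E)
⊕-interchange (a , a′) (b , b′) (d , d′) (e , e′) = cong₂ _,_ (eq a b d e) (eq a′ b′ d′ e′)
  where
  eq : ∀ a b d e → (a ℤ.+ b) ℤ.+ (d ℤ.+ e) ≡ (a ℤ.+ d) ℤ.+ (b ℤ.+ e)
  eq = solve-∀

α-++ : ∀ v w → α (v ++ w) ≡ α v ⊕ α w
α-++ []      w = sym (⊕-identityˡ (α w))
α-++ (A ∷ v) w = trans (cong (A ⊕_) (α-++ v w)) (sym (⊕-assoc A (α v) (α w)))

infixr 7 _⊙_
_⊙_ : ℤ → ℤ² → ℤ²
n ⊙ (x , y) = n ℤ.* x , n ℤ.* y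

α-replicate : ∀ n A → α (replicate n A) ≡ + n ⊙ A
α-replicate zero    A       = refl
α-replicate (suc n) A@(x , y) =
  trans (cong (A ⊕_) (α-replicate n A)) (cong₂ _,_ (sym (ℤ.suc-* (+ n) x)) (sym (ℤ.suc-* (+ n) y)))

-- Gordan's alternative for integer vectors in the plane.

dot det : ℤ² → ℤ² → ℤ
dot (u , v) (x , y) = u ℤ.* x ℤ.+ v ℤ.* y
det (u , v) (x , y) = u ℤ.* y ℤ.- v ℤ.* x

rotate : ℤ² → ℤ²
rotate (x , y) = ℤ.- y , x

0≤i*i : ∀ i → 0ℤ ℤ.≤ i ℤ.* i
0≤i*i (+ zero)  = ℤ.+≤+ ℕ.z≤n
0≤i*i +[1+ n ]  = ℤ.+≤+ ℕ.z≤n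
0≤i*i -[1+ n ]  = ℤ.+≤+ ℕ.z≤n

0<dot-self : ∀ A → ¬ (A ≡ O) → 0ℤ ℤ.< dot A A
0<dot-self (+[1+ _ ]  , y)         _   = ℤ.+-mono-<-≤ (ℤ.+<+ ℕ.z<s) (0≤i*i y)
0<dot-self (-[1+ _ ]  , y)         _   = ℤ.+-mono-<-≤ (ℤ.+<+ ℕ.z<s) (0≤i*i y)
0<dot-self (+ zero    , +[1+ _ ])  _   = ℤ.+<+ ℕ.z<s
0<dot-self (+ zero    , -[1+ _ ])  _   = ℤ.+<+ ℕ.z<s
0<dot-self (+ zero    , + zero)    A≢O = ⊥-elim (A≢O refl)

0<i*j : ∀ {i j} → 0ℤ ℤ.< i → 0ℤ ℤ.< j → 0ℤ ℤ.< i ℤ.* j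
0<i*j {i} {j} 0<i 0<j = subst (ℤ._< i ℤ.* j) (ℤ.*-zeroʳ i) (ℤ.*-monoˡ-<-pos i {{ℤ.positive 0<i}} 0<j)

0≤i*j : ∀ {i j} → 0ℤ ℤ.≤ i → 0ℤ ℤ.≤ j → 0ℤ ℤ.≤ i ℤ.* j
0≤i*j {i} {j} 0≤i 0≤j =
  subst (ℤ._≤ i ℤ.* j) (ℤ.*-zeroʳ i) (ℤ.*-monoˡ-≤-nonNeg i {{ℤ.nonNegative 0≤i}} 0≤j)

-- Over the integers `d` > 0 means `d` ≥ 1, so `N` · `d` is at least `N` and outweighs `e`.
0<N*d+e : ∀ N {d e} → 0ℤ ℤ.< d → ℤ.∣ e ∣ ℕ.< N → 0ℤ ℤ.< + N ℤ.* d ℤ.+ e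
0<N*d+e (suc n) {d} {e} 0<d (ℕ.s≤s ∣e∣≤n) = ℤ.<-≤-trans (0<N+e e ∣e∣≤n)
  (ℤ.+-monoˡ-≤ e (subst (ℤ._≤ + suc n ℤ.* d) (ℤ.*-identityʳ (+ suc n))
    (ℤ.*-monoˡ-≤-nonNeg (+ suc n) (ℤ.i<j⇒suc[i]≤j 0<d))))
  where
  0<N+e : ∀ e → ℤ.∣ e ∣ ℕ.≤ n → 0ℤ ℤ.< + suc n ℤ.+ e
  0<N+e (+ k)     _   = ℤ.+<+ ℕ.z<s
  0<N+e -[1+ k ] 1+k≤n = subst (0ℤ ℤ.<_) (sym (ℤ.⊖-≥ (ℕ.m≤n⇒m≤1+n 1+k≤n))) (ℤ.+<+ (ℕ.m<n⇒0<n∸m (ℕ.s≤s 1+k≤n)))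

PositiveOn : ℤ² → List ℤ² → Set
PositiveOn u = All (λ A → 0ℤ ℤ.< dot u A)

-- The letter `B` is split off to make the sequence nonempty. Entries may repeat, so nonnegative
-- integer combinations are covered.
VanishingSum : List ℤ² → Set
VanishingSum As = ∃₂ λ B Bs → All (_∈ₗ As) (B ∷ Bs) × α (B ∷ Bs) ≡ O

dot>0⇒≢O : ∀ {u A} → 0ℤ ℤ.< dot u A → ¬ (u ≡ O)
dot>0⇒≢O {A = x , y} 0<0 refl = ℤ.<-irrefl refl 0<0

dot-bound : ∀ B As → ∃ λ N → All (λ A → ℤ.∣ dot B A ∣ ℕ.< N) As
dot-bound B []       = 0 , []
dot-bound B (A ∷ As) with dot-bound B As
... | N , bs = suc ℤ.∣ dot B A ∣ ℕ.⊔ N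
             , ℕ.m≤m⊔n _ N
             ∷ All.map (λ b → ℕ.≤-trans b (ℕ.m≤n⊔m _ N)) bs

-- Adding `B` to a multiple of `v` gives the value `dot B B` > 0 at `B`, where `v` vanishes. On `As`
-- a multiple beyond all values of `dot B` drowns the perturbation.
tilt : ∀ {v B As} → ¬ (B ≡ O) → dot v B ≡ 0ℤ → PositiveOn v As →
       ∃ λ u → PositiveOn u (B ∷ As)
tilt {v} {B} {As} B≢O v⊥B v>0 with dot-bound B As
... | N , bs = + N ⊙ v ⊕ B
             , subst (0ℤ ℤ.<_) (sym self) (0<dot-self B B≢O)
             ∷ All.zipWith (λ { {A} (vA>0 , b) →
                 subst (0ℤ ℤ.<_) (sym (expand (+ N) v B A)) (0<N*d+e N vA>0 b) }) (v>0 , bs)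
  where
  expand : ∀ n v B A → dot (n ⊙ v ⊕ B) A ≡ n ℤ.* dot v A ℤ.+ dot B A
  expand n (v₁ , v₂) (b₁ , b₂) (a₁ , a₂) = eq n v₁ v₂ b₁ b₂ a₁ a₂
    where
    eq : ∀ n v₁ v₂ b₁ b₂ a₁ a₂ → (n ℤ.* v₁ ℤ.+ b₁) ℤ.* a₁ ℤ.+ (n ℤ.* v₂ ℤ.+ b₂) ℤ.* a₂
         ≡ n ℤ.* (v₁ ℤ.* a₁ ℤ.+ v₂ ℤ.* a₂) ℤ.+ (b₁ ℤ.* a₁ ℤ.+ b₂ ℤ.* a₂)
    eq = solve-∀
  self : dot (+ N ⊙ v ⊕ B) B ≡ dot B B
  self = trans (expand (+ N) v B B) (trans (cong (λ d → + N ℤ.* d ℤ.+ dot B B) v⊥B)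
    (trans (cong (ℤ._+ dot B B) (ℤ.*-zeroʳ (+ N))) (ℤ.+-identityˡ _)))

-- Each vector is repeated as often as its coefficient says; `i` > 0 makes the resulting word
-- nonempty.
combination⇒vanishing : ∀ {As} i j k {A B D} → A ∈ₗ As → B ∈ₗ As → D ∈ₗ As →
  0ℤ ℤ.< i → 0ℤ ℤ.≤ j → 0ℤ ℤ.≤ k → i ⊙ A ⊕ (j ⊙ B ⊕ k ⊙ D) ≡ O → VanishingSum As
combination⇒vanishing +[1+ l ] (+ m) (+ n) {A} {B} {D} A∈ B∈ D∈ _ _ _ eq =
  A , replicate l A ++ (replicate m B ++ replicate n D) ,
  A∈ ∷ All.++⁺ (All.replicate⁺ l A∈) (All.++⁺ (All.replicate⁺ m B∈) (All.replicate⁺ n D∈)) ,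
  (begin
    α (replicate (suc l) A ++ (replicate m B ++ replicate n D))
      ≡⟨ α-++ (replicate (suc l) A) _ ⟩
    α (replicate (suc l) A) ⊕ α (replicate m B ++ replicate n D)
      ≡⟨ cong₂ _⊕_ (α-replicate (suc l) A) (α-++ (replicate m B) _) ⟩
    +[1+ l ] ⊙ A ⊕ (α (replicate m B) ⊕ α (replicate n D))
      ≡⟨ cong (+[1+ l ] ⊙ A ⊕_) (cong₂ _⊕_ (α-replicate m B) (α-replicate n D)) ⟩
    +[1+ l ] ⊙ A ⊕ (+ m ⊙ B ⊕ + n ⊙ D)
      ≡⟨ eq ⟩
    O ∎)
  where open ≡-Reasoning
combination⇒vanishing (+ zero) _ _ _ _ _ (ℤ.+<+ ())

-- The vector (u·A) B - (u·B) A equals `det B A` times (u₂, -u₁), hence vanishes, and the signs of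
-- u·A and u·B make its coefficients admissible. The third vector is a dummy with coefficient 0.
parallel⇒vanishing : ∀ {As u A B} → A ∈ₗ As → B ∈ₗ As →
  0ℤ ℤ.< dot u A → dot u B ℤ.≤ 0ℤ → det B A ≡ 0ℤ → VanishingSum As
parallel⇒vanishing {u = u₁ , u₂} {A = A@(a₁ , a₂)} {B = B@(b₁ , b₂)} A∈ B∈ uA>0 uB≤0 ∥ =
  combination⇒vanishing (dot u A) (ℤ.- dot u B) 0ℤ B∈ A∈ A∈ uA>0 (ℤ.neg-mono-≤ uB≤0) ℤ.≤-refl
    (cong₂ _,_ (trans (eq₁ u₁ u₂ a₁ a₂ b₁ b₂) (trans (cong (u₂ ℤ.*_) ∥) (ℤ.*-zeroʳ u₂)))
               (trans (eq₂ u₁ u₂ a₁ a₂ b₁ b₂) (trans (cong (ℤ.- u₁ ℤ.*_) ∥) (ℤ.*-zeroʳ (ℤ.- u₁)))))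
  where
  u = u₁ , u₂
  eq₁ : ∀ u₁ u₂ a₁ a₂ b₁ b₂ →
    (u₁ ℤ.* a₁ ℤ.+ u₂ ℤ.* a₂) ℤ.* b₁ ℤ.+ ((ℤ.- (u₁ ℤ.* b₁ ℤ.+ u₂ ℤ.* b₂)) ℤ.* a₁ ℤ.+ 0ℤ)
    ≡ u₂ ℤ.* (b₁ ℤ.* a₂ ℤ.- b₂ ℤ.* a₁)
  eq₁ = solve-∀
  eq₂ : ∀ u₁ u₂ a₁ a₂ b₁ b₂ →
    (u₁ ℤ.* a₁ ℤ.+ u₂ ℤ.* a₂) ℤ.* b₂ ℤ.+ ((ℤ.- (u₁ ℤ.* b₁ ℤ.+ u₂ ℤ.* b₂)) ℤ.* a₂ ℤ.+ 0ℤ)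
    ≡ ℤ.- u₁ ℤ.* (b₁ ℤ.* a₂ ℤ.- b₂ ℤ.* a₁)
  eq₂ = solve-∀

-- The vectors A and D lie on different sides of the line through B; the three
-- are related by det B D · A − det B A · D + det D A · B = 0, in which the sign
-- of det D A is found by applying u.
opposite⇒vanishing : ∀ {As u A D B} → A ∈ₗ As → D ∈ₗ As → B ∈ₗ As →
  0ℤ ℤ.< dot u A → 0ℤ ℤ.< dot u D → dot u B ℤ.≤ 0ℤ → det B A ℤ.< 0ℤ → 0ℤ ℤ.≤ det B D → VanishingSum As
opposite⇒vanishing {u = u₁ , u₂} {A = A@(a₁ , a₂)} {D = D@(d₁ , d₂)} {B = B@(b₁ , b₂)}
  A∈ D∈ B∈ uA>0 uD>0 uB≤0 BA<0 BD≥0 =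
  combination⇒vanishing (ℤ.- det B A) (det B D) (det D A) D∈ A∈ B∈ -BA>0 BD≥0 DA≥0
    (cong₂ _,_ (eq₁ a₁ a₂ d₁ d₂ b₁ b₂) (eq₂ a₁ a₂ d₁ d₂ b₁ b₂))
  where
  u = u₁ , u₂
  -BA>0 : 0ℤ ℤ.< ℤ.- det B A
  -BA>0 = ℤ.neg-mono-< BA<0
  eq₁ : ∀ a₁ a₂ d₁ d₂ b₁ b₂ →
    (ℤ.- (b₁ ℤ.* a₂ ℤ.- b₂ ℤ.* a₁)) ℤ.* d₁ ℤ.+
      ((b₁ ℤ.* d₂ ℤ.- b₂ ℤ.* d₁) ℤ.* a₁ ℤ.+ (d₁ ℤ.* a₂ ℤ.- d₂ ℤ.* a₁) ℤ.* b₁) ≡ 0ℤ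
  eq₁ = solve-∀
  eq₂ : ∀ a₁ a₂ d₁ d₂ b₁ b₂ →
    (ℤ.- (b₁ ℤ.* a₂ ℤ.- b₂ ℤ.* a₁)) ℤ.* d₂ ℤ.+
      ((b₁ ℤ.* d₂ ℤ.- b₂ ℤ.* d₁) ℤ.* a₂ ℤ.+ (d₁ ℤ.* a₂ ℤ.- d₂ ℤ.* a₁) ℤ.* b₂) ≡ 0ℤ
  eq₂ = solve-∀
  under-u : ∀ u₁ u₂ a₁ a₂ d₁ d₂ b₁ b₂ →
    (ℤ.- (b₁ ℤ.* a₂ ℤ.- b₂ ℤ.* a₁)) ℤ.* (u₁ ℤ.* d₁ ℤ.+ u₂ ℤ.* d₂) ℤ.+
      (b₁ ℤ.* d₂ ℤ.- b₂ ℤ.* d₁) ℤ.* (u₁ ℤ.* a₁ ℤ.+ u₂ ℤ.* a₂)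
    ≡ ℤ.- ((ℤ.- (d₁ ℤ.* a₂ ℤ.- d₂ ℤ.* a₁)) ℤ.* (ℤ.- (u₁ ℤ.* b₁ ℤ.+ u₂ ℤ.* b₂)))
  under-u = solve-∀
  DA≥0 : 0ℤ ℤ.≤ det D A
  DA≥0 = ℤ.≮⇒≥ λ DA<0 → ℤ.<⇒≱
    (ℤ.+-mono-<-≤ (0<i*j -BA>0 uD>0) (0≤i*j BD≥0 (ℤ.<⇒≤ uA>0)))
    (subst (ℤ._≤ 0ℤ) (sym (under-u u₁ u₂ a₁ a₂ d₁ d₂ b₁ b₂))
      (ℤ.neg-mono-≤ (0≤i*j (ℤ.neg-mono-≤ (ℤ.<⇒≤ DA<0)) (ℤ.neg-mono-≤ uB≤0))))

dot-rotate : ∀ B A → dot (rotate B) A ≡ det B A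
dot-rotate (b₁ , b₂) (a₁ , a₂) = eq b₁ b₂ a₁ a₂
  where
  eq : ∀ b₁ b₂ a₁ a₂ → ℤ.- b₂ ℤ.* a₁ ℤ.+ b₁ ℤ.* a₂ ≡ b₁ ℤ.* a₂ ℤ.- b₂ ℤ.* a₁
  eq = solve-∀

dot-neg : ∀ u A → dot (ℤ.-1ℤ ⊙ u) A ≡ ℤ.- dot u A
dot-neg (u₁ , u₂) (a₁ , a₂) = eq u₁ u₂ a₁ a₂
  where
  eq : ∀ u₁ u₂ a₁ a₂ → ℤ.-1ℤ ℤ.* u₁ ℤ.* a₁ ℤ.+ ℤ.-1ℤ ℤ.* u₂ ℤ.* a₂ ≡ ℤ.- (u₁ ℤ.* a₁ ℤ.+ u₂ ℤ.* a₂)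
  eq = solve-∀

det-self : ∀ B → det B B ≡ 0ℤ
det-self (b₁ , b₂) = eq b₁ b₂
  where
  eq : ∀ b₁ b₂ → b₁ ℤ.* b₂ ℤ.- b₂ ℤ.* b₁ ≡ 0ℤ
  eq = solve-∀

-- If `det B` has one strict sign on `As`, then `rotate B` or its negative vanishes on `B` and is
-- positive on `As`, ready to be tilted. Otherwise some `A` has `det B A` ≤ 0 and some `D` has
-- `det B D` ≥ 0: either `A` lies on the line through `B`, or that line separates `A` from `D`.
alternative-step : ∀ {u B As} → PositiveOn u As → dot u B ℤ.≤ 0ℤ →
  (∃ λ u → PositiveOn u (B ∷ As)) ⊎ VanishingSum (B ∷ As)
alternative-step {u} {B} {As} u>0 uB≤0 with ≡-dec ℤ._≟_ ℤ._≟_ B O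
-- The one-letter word `O` already vanishes; below, `B` is nonzero, as `tilt` demands.
... | yes refl = inj₂ (O , [] , here refl ∷ [] , refl)
... | no B≢O with All.all? (λ A → 0ℤ ℤ.<? det B A) As
...   | yes pos = inj₁ (tilt {rotate B} B≢O (trans (dot-rotate B B) (det-self B))
                     (All.map (λ {A} → subst (0ℤ ℤ.<_) (sym (dot-rotate B A))) pos))
...   | no ¬pos with All.all? (λ A → det B A ℤ.<? 0ℤ) As
...     | yes neg = inj₁ (tilt {ℤ.-1ℤ ⊙ rotate B} B≢O (trans (rot⁻ B) (cong ℤ.-_ (det-self B)))
                     (All.map (λ {A} p → subst (0ℤ ℤ.<_) (sym (rot⁻ A)) (ℤ.neg-mono-< p)) neg))
  where
  rot⁻ : ∀ A → dot (ℤ.-1ℤ ⊙ rotate B) A ≡ ℤ.- det B A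
  rot⁻ A = trans (dot-neg (rotate B) A) (cong ℤ.-_ (dot-rotate B A))
...     | no ¬neg
  with find (All.¬All⇒Any¬ (λ A → 0ℤ ℤ.<? det B A) As ¬pos)
     | find (All.¬All⇒Any¬ (λ A → det B A ℤ.<? 0ℤ) As ¬neg)
...       | A , A∈ , BA≯0 | D , D∈ , BD≮0 with ℤ.<-cmp (det B A) 0ℤ
...         | tri< BA<0 _ _ = inj₂ (opposite⇒vanishing {u = u} {A} {D} {B} (there A∈) (there D∈) (here refl)
                                (All.lookup u>0 A∈) (All.lookup u>0 D∈) uB≤0 BA<0 (ℤ.≮⇒≥ BD≮0))
...         | tri≈ _ BA≡0 _ = inj₂ (parallel⇒vanishing {u = u} {A} {B} (there A∈) (here refl)
                                (All.lookup u>0 A∈) uB≤0 BA≡0)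
...         | tri> _ _ BA>0 = ⊥-elim (BA≯0 BA>0)

-- The order on ℤ is decidable, so the case distinction, and with it the theorem, needs no excluded
-- middle.
alternative : ∀ As → (∃ λ u → ¬ (u ≡ O) × PositiveOn u As) ⊎ VanishingSum As
-- Even for the empty list the functional has to be nonzero, since it becomes the normal of a
-- half-plane.
alternative []       = inj₁ ((1ℤ , 0ℤ) , (λ ()) , [])
alternative (B ∷ As) with alternative As
... | inj₂ (D , Ds , ∈s , eq) = inj₂ (D , Ds , All.map there ∈s , eq)
... | inj₁ (u , u≢O , u>0) with 0ℤ ℤ.<? dot u B
...   | yes uB>0 = inj₁ (u , u≢O , uB>0 ∷ u>0)
...   | no uB≯0 with alternative-step {u} u>0 (ℤ.≮⇒≥ uB≯0)
...     | inj₂ vs = inj₂ vs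
...     | inj₁ (v , vB>0 ∷ v>0) = inj₁ (v , dot>0⇒≢O {v} {B} vB>0 , vB>0 ∷ v>0)

-- Finitely many paths from a positive functional.

letters-admissible : ∀ (C : Pred ℤ² c) w → w ∈ 𝓕[ X , C ] → All (Admissible X C) w
letters-admissible {X = X} C w w∈ = All.tabulate admissible
  where
  admissible : ∀ {A} → A ∈ₗ w → A ∈ Admissible X C
  admissible A∈w with ∈-∃++ A∈w
  ... | u , v , refl with All.++⁻ u (proj₁ w∈)
  ...   | u∈ , A∈ ∷ v∈ = A∈ , u , v , u∈ , v∈ , w∈

dot-⊕ : ∀ u A B → dot u (A ⊕ B) ≡ dot u A ℤ.+ dot u B
dot-⊕ (u , v) (x , y) (x′ , y′) = eq u v x y x′ y′
  where
  eq : ∀ u v x y x′ y′ → u ℤ.* (x ℤ.+ x′) ℤ.+ v ℤ.* (y ℤ.+ y′)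
       ≡ (u ℤ.* x ℤ.+ v ℤ.* y) ℤ.+ (u ℤ.* x′ ℤ.+ v ℤ.* y′)
  eq = solve-∀

-- An integer functional that is positive on a letter gains at least 1 there.
length≤dot : ∀ {w} u → PositiveOn u w → + length w ℤ.≤ dot u (α w)
length≤dot {[]}    (x , y) [] = ℤ.≤-reflexive (sym (cong₂ ℤ._+_ (ℤ.*-zeroʳ x) (ℤ.*-zeroʳ y)))
length≤dot {A ∷ w} u (A>0 ∷ w>0) = subst (+ suc (length w) ℤ.≤_) (sym (dot-⊕ u A (α w)))
  (ℤ.+-mono-≤ (ℤ.i<j⇒suc[i]≤j A>0) (length≤dot u w>0))

wordsUpTo : List ℤ² → ℕ → List Word
wordsUpTo As zero    = [ [] ]
wordsUpTo As (suc n) = [] ∷ cartesianProductWith _∷_ As (wordsUpTo As n)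

∈-wordsUpTo : ∀ {w} n → All (_∈ₗ As) w → length w ℕ.≤ n → w ∈ₗ wordsUpTo As n
∈-wordsUpTo zero    []         _       = here refl
∈-wordsUpTo (suc n) []         _       = here refl
∈-wordsUpTo (suc n) (A∈ ∷ w∈) (s≤s l) = there (∈-cartesianProductWith⁺ _∷_ A∈ (∈-wordsUpTo n w∈ l))

lookup-injective : ∀ {A : Set a} {xs : List A} → Unique xs → ∀ i j → lookup xs i ≡ lookup xs j → i ≡ j
lookup-injective (x≢ ∷ xs!) zero    zero    _  = refl
lookup-injective (x≢ ∷ xs!) zero    (suc j) eq = ⊥-elim (All.lookup x≢ (∈-lookup j) eq)
lookup-injective (x≢ ∷ xs!) (suc i) zero    eq = ⊥-elim (All.lookup x≢ (∈-lookup i) (sym eq))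
lookup-injective (x≢ ∷ xs!) (suc i) (suc j) eq = cong suc (lookup-injective xs! i j eq)

-- Pigeonhole: distinct entries of `xs` have distinct positions in `ys`.
Unique-⊆⇒length≤ : ∀ {A : Set a} {xs ys : List A} → Unique xs → All (_∈ₗ ys) xs → length xs ℕ.≤ length ys
Unique-⊆⇒length≤ {xs = xs} xs! xs⊆ys = injective⇒≤ {f = λ i → index (∈ys i)}
  λ {i} {j} eq → lookup-injective xs! i j
    (Membershipₛ.index-injective (setoid _) (∈ys i) (∈ys j) eq)
  where
  ∈ys = λ i → All.lookup xs⊆ys (∈-lookup i)

positive⇒FPP : ∀ u → PositiveOn u As → (∀ {A} → A ∈ Admissible X C → A ∈ₗ As) → FPP X C
positive⇒FPP {As = As} {X = X} {C = C} u u>0 Y⊆As A _ = length (wordsUpTo As n) , λ ws ws! ws∈ →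
  Unique-⊆⇒length≤ ws! (All.map path∈ ws∈)
  where
  -- The absolute value only produces a natural number: at the end of a path `dot u A` is
  -- nonnegative.
  n = ℤ.∣ dot u A ∣
  path∈ : ∀ {w} → Path X C A w → w ∈ₗ wordsUpTo As n
  path∈ {w} (w∈ , refl) = ∈-wordsUpTo n w⊆As (ℤ.drop‿+≤+
      (ℤ.≤-trans (length≤dot u w>0) (ℤ.≤-reflexive (sym (ℤ.0≤i⇒+∣i∣≡i
        (ℤ.≤-trans (ℤ.+≤+ z≤n) (length≤dot u w>0)))))))
    where
    w⊆As = All.map Y⊆As (letters-admissible C w w∈)
    w>0 = All.map (All.lookup u>0) w⊆As

-- Infinitely many paths from a vanishing sum.

-- The condition on prefixes relative to a starting point `P`, so that a concatenation can be
-- checked piece by piece.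
StaysIn : Pred ℤ² c → ℤ² → Word → Set c
StaysIn C P w = ∀ m → m ℕ.≤ length w → (P ⊕ α (σ m w)) ∈ C

StaysIn-++ : ∀ (C : Pred ℤ² c) P w {v} → StaysIn C P w → StaysIn C (P ⊕ α w) v → StaysIn C P (w ++ v)
StaysIn-++ C P []      {v} _  sv m       m≤ =
  subst (λ Q → (Q ⊕ α (σ m v)) ∈ C) (⊕-identityʳ P) (sv m m≤)
StaysIn-++ C P (A ∷ w)     sw _  zero    _  = sw zero z≤n
StaysIn-++ C P (A ∷ w) {v} sw sv (suc m) (s≤s m≤) =
  subst (_∈ C) (⊕-assoc P A _) (StaysIn-++ C (P ⊕ A) w
    (λ k k≤ → subst (_∈ C) (sym (⊕-assoc P A _)) (sw (suc k) (s≤s k≤)))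
    (λ k k≤ → subst (λ Q → (Q ⊕ α (σ k v)) ∈ C) (sym (⊕-assoc P A (α w))) (sv k k≤))
    m m≤)

endpoint-∈ : ∀ (C : Pred ℤ² c) w → w ∈ 𝓕[ X , C ] → α w ∈ C
endpoint-∈ C w (_ , s) =
  subst (λ t → α t ∈ C) (List.take-all (length w) w ℕ.≤-refl) (s (length w) ℕ.≤-refl)

prefix-∈𝓕 : ∀ (C : Pred ℤ² c) v w → (v ++ w) ∈ 𝓕[ X , C ] → v ∈ 𝓕[ X , C ]
prefix-∈𝓕 C v w (vw∈ , s) = All.++⁻ˡ v vw∈ , λ m m≤ →
  subst (λ t → α t ∈ C) (take-++ m v m≤)
    (s m (ℕ.≤-trans m≤ (subst (length v ℕ.≤_) (sym (List.length-++ v)) (ℕ.m≤m+n (length v) _))))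
  where
  take-++ : ∀ m v → m ℕ.≤ length v → σ m (v ++ w) ≡ σ m v
  take-++ zero    v       _        = refl
  take-++ (suc m) (A ∷ v) (s≤s m≤) = cong (A ∷_) (take-++ m v m≤)

++-∈𝓕 : ∀ (C : Pred ℤ² c) w v → w ∈ 𝓕[ X , C ] → v ∈ 𝓕 X → StaysIn C (α w) v → (w ++ v) ∈ 𝓕[ X , C ]
++-∈𝓕 C w v (w∈ , sw) v∈ sv = All.++⁺ w∈ v∈ , λ m m≤ →
  subst (_∈ C) (⊕-identityˡ _) (StaysIn-++ C O w
    (λ m m≤ → subst (_∈ C) (sym (⊕-identityˡ _)) (sw m m≤))
    (λ m m≤ → subst (λ Q → (Q ⊕ α (σ m v)) ∈ C) (sym (⊕-identityˡ (α w))) (sv m m≤))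
    m m≤)

-- The paths leading to the single steps of v are walked first, one after the
-- other: the points of v are then sums of points of C.
approach : IsSubmonoid C → ∀ v → All (Admissible X C) v →
           ∃ λ w → w ∈ 𝓕[ X , C ] × StaysIn C (α w) v
approach {C = C} submonoid [] [] = [] , ([] , λ { zero _ → O∈ }) , λ { zero _ → O∈ }
  where open IsSubmonoid submonoid
approach {C = C} submonoid (A ∷ v) ((A∈ , u , u′ , _ , _ , uAu′∈) ∷ adm)
  with approach submonoid v adm
... | w , w∈@(wX , sw) , sv =
    u ++ w , ++-∈𝓕 C u w u∈ wX (λ m m≤ → ⊕-closed {α u} {α (σ m w)} (endpoint-∈ C u u∈) (sw m m≤)) , stays
  where
  open IsSubmonoid submonoid
  u∈ = prefix-∈𝓕 C u (A ∷ u′) uAu′∈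
  uA∈ : (α u ⊕ A) ∈ C
  uA∈ = subst (_∈ C) (trans (α-++ u [ A ]) (cong (α u ⊕_) (⊕-identityʳ A)))
    (endpoint-∈ C (u ++ [ A ]) (prefix-∈𝓕 C (u ++ [ A ]) u′
      (subst (_∈ 𝓕[ _ , C ]) (sym (List.++-assoc u [ A ] u′)) uAu′∈)))
  stays : StaysIn C (α (u ++ w)) (A ∷ v)
  stays zero    _        = subst (λ Q → (Q ⊕ O) ∈ C) (sym (α-++ u w))
    (subst (_∈ C) (sym (⊕-assoc (α u) (α w) O)) (⊕-closed {α u} {α w ⊕ O} (endpoint-∈ C u u∈) (sv zero z≤n)))
  -- The letter `A` is regrouped with `α u`: both `α u ⊕ A` and `α w ⊕ α (σ m v)` lie in `C`.
  stays (suc m) (s≤s m≤) = subst (_∈ C)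
    (trans (⊕-interchange (α u) A (α w) _) (cong (_⊕ (A ⊕ α (σ m v))) (sym (α-++ u w))))
    (⊕-closed {α u ⊕ A} {α w ⊕ α (σ m v)} uA∈ (sv m m≤))

power : ℕ → Word → Word
power k v = concat (replicate k v)

α-power : ∀ k {v} → α v ≡ O → α (power k v) ≡ O
α-power zero        _   = refl
α-power (suc k) {v} αv≡O = trans (α-++ v (power k v)) (cong₂ _⊕_ αv≡O (α-power k αv≡O))

-- Since `v` sums to `O`, each copy of it starts at `P` again.
StaysIn-power : ∀ (C : Pred ℤ² c) P k v → α v ≡ O → StaysIn C P [] → StaysIn C P v → StaysIn C P (power k v)
StaysIn-power C P zero    v αv≡O s[] sv = s[]
StaysIn-power C P (suc k) v αv≡O s[] sv = StaysIn-++ C P v sv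
  (subst (λ Q → StaysIn C Q (power k v)) (sym (trans (cong (P ⊕_) αv≡O) (⊕-identityʳ P)))
    (StaysIn-power C P k v αv≡O s[] sv))

power-injective : ∀ {A v} i j → power i (A ∷ v) ≡ power j (A ∷ v) → i ≡ j
power-injective zero    zero    _  = refl
power-injective {v = v} (suc i) (suc j) eq =
  cong suc (power-injective i j (List.++-cancelˡ (_ ∷ v) _ _ eq))

vanishing⇒¬FPP : IsSubmonoid C → VanishingSum As → (∀ {A} → A ∈ₗ As → A ∈ Admissible X C) → ¬ FPP X C
vanishing⇒¬FPP {C = C} {X = X} submonoid (B , Bs , B∷Bs⊆As , sum≡O) As⊆Y fpp
  with approach submonoid (B ∷ Bs) (All.map As⊆Y B∷Bs⊆As)
-- One more of the distinct paths `path k` is listed than the claimed bound allows.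
... | u , u∈ , stays = ℕ.1+n≰n (subst (ℕ._≤ proj₁ finite) (List.length-applyUpTo path (suc (proj₁ finite)))
    (proj₂ finite (applyUpTo path (suc (proj₁ finite)))
      (Unique.applyUpTo⁺₁ path _ (λ {i} {j} i<j _ eq → ℕ.<⇒≢ i<j (path-injective i j eq)))
      (All.applyUpTo⁺₂ path _ path∈)))
  where
  finite = fpp (α u) (u , u∈ , refl)
  path : ℕ → Word
  path k = u ++ power k (B ∷ Bs)
  path-injective : ∀ i j → path i ≡ path j → i ≡ j
  path-injective i j eq = power-injective i j (List.++-cancelˡ u _ _ eq)
  path∈ : ∀ k → Path X C (α u) (path k)
  path∈ k = ++-∈𝓕 C u (power k (B ∷ Bs)) u∈
      (All.concat⁺ (All.replicate⁺ k (All.map (proj₁ ∘ As⊆Y) B∷Bs⊆As)))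
      (StaysIn-power C (α u) k (B ∷ Bs) sum≡O (λ { zero _ → stays zero z≤n }) stays)
    , trans (α-++ u (power k (B ∷ Bs))) (trans (cong (α u ⊕_) (α-power k sum≡O)) (⊕-identityʳ (α u)))

-- Integers as rationals.

toℚᵘ-/1 : ∀ i → toℚᵘ (i / 1) ≃ mkℚᵘ i 0
toℚᵘ-/1 i = ℚ.toℚᵘ-fromℚᵘ (mkℚᵘ i 0)

-- The fraction `i / 1` is normalised by a gcd that does not reduce for variable `i`, so the
-- computation is made with unnormalised rationals.
/1-homo-+ : ∀ i j → (i ℤ.+ j) / 1 ≡ i / 1 + j / 1
/1-homo-+ i j = ℚ.toℚᵘ-injective (begin
  toℚᵘ ((i ℤ.+ j) / 1)             ≈⟨ toℚᵘ-/1 (i ℤ.+ j) ⟩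
  mkℚᵘ (i ℤ.+ j) 0                 ≈⟨ *≡* (cong (ℤ._* 1ℤ) (cong₂ ℤ._+_ (sym (ℤ.*-identityʳ i)) (sym (ℤ.*-identityʳ j)))) ⟩
  mkℚᵘ i 0 ℚᵘ.+ mkℚᵘ j 0           ≈⟨ ℚᵘ.+-cong (toℚᵘ-/1 i) (toℚᵘ-/1 j) ⟨
  toℚᵘ (i / 1) ℚᵘ.+ toℚᵘ (j / 1)   ≈⟨ ℚ.toℚᵘ-homo-+ (i / 1) (j / 1) ⟨
  toℚᵘ (i / 1 + j / 1)             ∎)
  where open import Relation.Binary.Reasoning.Setoid ℚᵘ.≃-setoid

/1-homo-* : ∀ i j → (i ℤ.* j) / 1 ≡ i / 1 * (j / 1)
/1-homo-* i j = ℚ.toℚᵘ-injective (begin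
  toℚᵘ ((i ℤ.* j) / 1)             ≈⟨ toℚᵘ-/1 (i ℤ.* j) ⟩
  mkℚᵘ i 0 ℚᵘ.* mkℚᵘ j 0           ≈⟨ ℚᵘ.*-cong (toℚᵘ-/1 i) (toℚᵘ-/1 j) ⟨
  toℚᵘ (i / 1) ℚᵘ.* toℚᵘ (j / 1)   ≈⟨ ℚ.toℚᵘ-homo-* (i / 1) (j / 1) ⟨
  toℚᵘ (i / 1 * (j / 1))           ∎)
  where open import Relation.Binary.Reasoning.Setoid ℚᵘ.≃-setoid

/1-injective : ∀ {i j} → i / 1 ≡ j / 1 → i ≡ j
/1-injective {i} {j} eq with ℚ./-injective-≃ (mkℚᵘ i 0) (mkℚᵘ j 0) eq
... | *≡* i*1≡j*1 = ℤ.*-cancelʳ-≡ i j 1ℤ i*1≡j*1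

0<i⇒1≤i/1 : ∀ {i} → 0ℤ ℤ.< i → 1ℚ ≤ i / 1
0<i⇒1≤i/1 {i} 0<i = ℚ.toℚᵘ-cancel-≤ (ℚᵘ.≤-respʳ-≃ (ℚᵘ.≃-sym (toℚᵘ-/1 i))
  (*≤* (ℤ.*-monoʳ-≤-nonNeg 1ℤ (ℤ.i<j⇒suc[i]≤j 0<i))))

-- Limits of rational sequences.

∣p∣<q⇒p<q : ∀ {p q} → ∣ p ∣ < q → p < q
∣p∣<q⇒p<q {p} {q} ∣p∣<q with ℚ.∣p∣≡p∨∣p∣≡-p p
... | inj₁ eq = subst (_< q) eq ∣p∣<q
... | inj₂ eq = ℚ.≤-<-trans
    (subst₂ _≤_ (trans (cong -_ eq) (neg-involutive p)) refl (ℚ.neg-antimono-≤ (ℚ.0≤∣p∣ p)))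
    (ℚ.≤-<-trans (ℚ.0≤∣p∣ p) ∣p∣<q)

-- For a rational `q`, `x ≈ᵣ fromℚ q` unfolds to `seq x ⟶ q`.
_⟶_ : (ℕ → ℚ) → ℚ → Set
s ⟶ q = ∀ ε → 0ℚ < ε → ∃ λ N → ∀ n → N ℕ.≤ n → ∣ s n - q ∣ < ε

constant-⟶ : ∀ s q → (∀ n → s n ≡ q) → s ⟶ q
constant-⟶ s q s≡q ε 0<ε = 0 , λ n _ →
  subst (_< ε) (cong ∣_∣ (sym (trans (cong (_- q) (s≡q n)) (ℚ.+-inverseʳ q)))) 0<ε

⟶-+ : ∀ s t p q → s ⟶ p → t ⟶ q → (λ n → s n + t n) ⟶ (p + q)
⟶-+ s t p q s⟶p t⟶q ε 0<ε with s⟶p (½ * ε) (half>0 0<ε) | t⟶q (½ * ε) (half>0 0<ε)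
... | N , f | M , g = N ℕ.⊔ M , λ n n≥ →
    triangle ε (eq (s n) p (t n) q) (f n (ℕ.m⊔n≤o⇒m≤o N M n≥)) (g n (ℕ.m⊔n≤o⇒n≤o N M n≥))
  where
  open ℚ-Solver.+-*-Solver
  eq : ∀ a c b d → (a - c) + (b - d) ≡ (a + b) - (c + d)
  eq = solve 4 (λ a c b d → (a :- c) :+ (b :- d) := (a :+ b) :- (c :+ d)) refl

⟶-scale : ∀ r s p → s ⟶ p → (λ n → r * s n) ⟶ (r * p)
⟶-scale r s p s⟶p ε 0<ε = proj₁ close , λ n n≥ → subst (λ t → ∣ t ∣ < ε) (eq r (s n) p)
    (proj₂ (proj₂ δ) r (s n - p) ∣r∣≤1+∣r∣ (proj₂ close n n≥))
  where
  open ℚ-Solver.+-*-Solver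
  eq : ∀ r a p → r * (a - p) ≡ r * a - r * p
  eq = solve 3 (λ r a p → r :* (a :- p) := r :* a :- r :* p) refl
  -- `scale` asks for a positive bound, and `r` may be 0.
  δ = scale {1ℚ + ∣ r ∣} (ℚ.+-mono-<-≤ (ℚ.positive⁻¹ 1ℚ) (ℚ.0≤∣p∣ r)) 0<ε
  close = s⟶p (proj₁ δ) (proj₁ (proj₂ δ))
  ∣r∣≤1+∣r∣ : ∣ r ∣ ≤ 1ℚ + ∣ r ∣
  ∣r∣≤1+∣r∣ = subst (_≤ 1ℚ + ∣ r ∣) (ℚ.+-identityˡ ∣ r ∣) (ℚ.+-monoˡ-≤ ∣ r ∣ (ℚ.nonNegative⁻¹ 1ℚ))

⟶⇒eventually> : ∀ s p q → s ⟶ p → q < p → ∃ λ N → ∀ n → N ℕ.≤ n → q < s n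
⟶⇒eventually> s p q s⟶p q<p with s⟶p (p - q) (subst (_< p - q) (ℚ.+-inverseʳ q) (ℚ.+-monoˡ-< (- q) q<p))
... | N , f = N , λ n n≥ → subst₂ _<_ (eq₁ (s n) p q) (eq₂ (s n) p q)
      (ℚ.+-monoʳ-< (s n + q - p) (∣p∣<q⇒p<q (subst (_< p - q)
        (trans (sym (ℚ.∣-p∣≡∣p∣ (s n - p))) (cong ∣_∣ (eq₃ (s n) p))) (f n n≥))))
  where
  open ℚ-Solver.+-*-Solver
  eq₁ : ∀ s p q → s + q - p + (p - s) ≡ q
  eq₁ = solve 3 (λ s p q → s :+ q :- p :+ (p :- s) := q) refl
  eq₂ : ∀ s p q → s + q - p + (p - q) ≡ s
  eq₂ = solve 3 (λ s p q → s :+ q :- p :+ (p :- q) := s) refl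
  eq₃ : ∀ s p → - (s - p) ≡ p - s
  eq₃ = solve 2 (λ s p → :- (s :- p) := p :- s) refl

constant-⟶⇒≡ : ∀ {p q} → (λ _ → p) ⟶ q → p ≡ q
constant-⟶⇒≡ {p} {q} lim with p - q ℚ.≟ 0ℚ
... | yes p-q≡0 = trans (sym (eq p q)) (trans (cong (_+ q) p-q≡0) (ℚ.+-identityˡ q))
  where
  open ℚ-Solver.+-*-Solver
  eq : ∀ p q → p - q + q ≡ p
  eq = solve 2 (λ p q → p :- q :+ q := p) refl
... | no p-q≢0 = ⊥-elim (ℚ.<-irrefl refl (proj₂ close (proj₁ close) ℕ.≤-refl))
  where
  0<∣p-q∣ : 0ℚ < ∣ p - q ∣
  0<∣p-q∣ = ℚ.≰⇒> λ ∣p-q∣≤0 → p-q≢0 (ℚ.∣p∣≡0⇒p≡0 (p - q) (ℚ.≤-antisym ∣p-q∣≤0 (ℚ.0≤∣p∣ (p - q))))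
  close = lim ∣ p - q ∣ 0<∣p-q∣

-- The LC from a positive functional.

≈²-refl : ∀ {p} → p ≈² p
≈²-refl {x , y} = reflexive x , reflexive y
  where
  reflexive : ∀ x → x ≈ᵣ x
  reflexive x ε 0<ε = 0 , λ n _ → subst (_< ε) (cong ∣_∣ (sym (ℚ.+-inverseʳ (seq x n)))) 0<ε

≢O⇒ι≉0² : ∀ {u} → ¬ (u ≡ O) → ¬ (ι u ≈² 0²)
≢O⇒ι≉0² u≢O (x≈0 , y≈0) = u≢O (cong₂ _,_ (/1-injective (constant-⟶⇒≡ x≈0)) (/1-injective (constant-⟶⇒≡ y≈0)))

/1-dot : ∀ u A → dot u A / 1 ≡ proj₁ u / 1 * (proj₁ A / 1) + proj₂ u / 1 * (proj₂ A / 1)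
/1-dot (u , v) (x , y) = trans (/1-homo-+ (u ℤ.* x) (v ℤ.* y)) (cong₂ _+_ (/1-homo-* u x) (/1-homo-* v y))

-- As a positive integer, `dot u A` is at least 1. The terms for `p` merely converge to it, but
-- eventually exceed ½, which serves as a uniform gap.
positive⇒eventually≥½ : ∀ u {A p} → 0ℤ ℤ.< dot u A → p ≈² ι A →
  ∃ λ N → ∀ n → N ℕ.≤ n → ½ ≤ proj₁ u / 1 * seq (proj₁ p) n + proj₂ u / 1 * seq (proj₂ p) n
positive⇒eventually≥½ u {A} {p} uA>0 (x≈ , y≈) = proj₁ eventually , λ n n≥ → ℚ.<⇒≤ (proj₂ eventually n n≥)
  where
  r s x y : ℚ
  r = proj₁ u / 1
  s = proj₂ u / 1
  x = proj₁ A / 1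
  y = proj₂ A / 1
  ½<1 : ½ < 1ℚ
  ½<1 = ℚ.*<* (ℤ.+<+ (s≤s (s≤s z≤n)))
  eventually : ∃ λ N → ∀ n → N ℕ.≤ n → ½ < r * seq (proj₁ p) n + s * seq (proj₂ p) n
  eventually = ⟶⇒eventually> _ (r * x + s * y) ½
    (⟶-+ (λ n → r * seq (proj₁ p) n) (λ n → s * seq (proj₂ p) n) (r * x) (s * y)
      (⟶-scale r (seq (proj₁ p)) x x≈) (⟶-scale s (seq (proj₂ p)) y y≈))
    (ℚ.<-≤-trans ½<1 (subst (1ℚ ≤_) (/1-dot u A) (0<i⇒1≤i/1 uA>0)))

positive⇒LC : ∀ {S : Pred ℤ² ℓ} u → ¬ (u ≡ O) → (∀ {A} → A ∈ S → 0ℤ ℤ.< dot u A) → LC S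
positive⇒LC u u≢O u>0 = ι u , ≢O⇒ι≉0² u≢O , λ { {p} (A , A∈S , p≈A) →
  ½ , ℚ.positive⁻¹ ½ , positive⇒eventually≥½ u {A} {p} (u>0 A∈S) p≈A }

-- A positive functional keeps the origin out of the convex hull.

0≤ᵣ-+ : ∀ x y → 0ᵣ ≤ᵣ x → 0ᵣ ≤ᵣ y → 0ᵣ ≤ᵣ x +ᵣ y
0≤ᵣ-+ x y 0≤x 0≤y ε 0<ε = N ℕ.⊔ M , λ n n≥ →
  subst (0ℚ ≤_) (trans (eq (seq x n) (seq y n) (½ * ε)) (cong (λ t → seq x n + seq y n + t) (halves ε)))
    (ℚ.+-mono-≤ (proj₂ x+½ε≥0 n (ℕ.m⊔n≤o⇒m≤o N M n≥)) (proj₂ y+½ε≥0 n (ℕ.m⊔n≤o⇒n≤o N M n≥)))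
  where
  open ℚ-Solver.+-*-Solver
  eq : ∀ a b h → (a + h) + (b + h) ≡ a + b + (h + h)
  eq = solve 3 (λ a b h → (a :+ h) :+ (b :+ h) := a :+ b :+ (h :+ h)) refl
  x+½ε≥0 = 0≤x (½ * ε) (half>0 0<ε)
  y+½ε≥0 = 0≤y (½ * ε) (half>0 0<ε)
  N = proj₁ x+½ε≥0
  M = proj₁ y+½ε≥0

0≤ᵣ-Σᵣ : ∀ {k} (f : Fin k → ℝ) → (∀ i → 0ᵣ ≤ᵣ f i) → 0ᵣ ≤ᵣ Σᵣ f
0≤ᵣ-Σᵣ {zero}  f _   ε 0<ε = 0 , λ _ _ → subst (0ℚ ≤_) (sym (ℚ.+-identityˡ ε)) (ℚ.<⇒≤ 0<ε)
0≤ᵣ-Σᵣ {suc k} f 0≤f = 0≤ᵣ-+ (f zero) (Σᵣ (f ∘ suc)) (0≤f zero) (0≤ᵣ-Σᵣ (f ∘ suc) (0≤f ∘ suc))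

0≤w*y+ε : ∀ {w y η ε} → 0ℚ ≤ y → 0ℚ ≤ w + η → ∣ y * η ∣ < ε → 0ℚ ≤ w * y + ε
0≤w*y+ε {w} {y} {η} {ε} 0≤y 0≤w+η ∣yη∣<ε = begin
  0ℚ             ≡⟨ ℚ.*-zeroˡ y ⟨
  0ℚ * y         ≤⟨ ℚ.*-monoʳ-≤-nonNeg y {{ℚ.nonNegative 0≤y}} 0≤w+η ⟩
  (w + η) * y    ≡⟨ eq w η y ⟩
  w * y + y * η  ≤⟨ ℚ.+-monoʳ-≤ (w * y) (ℚ.<⇒≤ (∣p∣<q⇒p<q {y * η} ∣yη∣<ε)) ⟩
  w * y + ε      ∎
  where
  open ℚ.≤-Reasoning
  eq : ∀ a h b → (a + h) * b ≡ a * b + b * h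
  eq = solve 3 (λ a h b → (a :+ h) :* b := a :* b :+ b :* h) refl
    where open ℚ-Solver.+-*-Solver

-- The terms of `x` are nonnegative only up to arbitrarily small errors, those of `y` exactly from
-- some index on. As `y` is bounded, a small enough error in `x` costs less than `ε` in the product.
0≤ᵣ-* : ∀ x y → 0ᵣ ≤ᵣ x → (∃ λ N → ∀ n → N ℕ.≤ n → 0ℚ ≤ seq y n) → 0ᵣ ≤ᵣ x *ᵣ y
0≤ᵣ-* x y 0≤x (N , 0≤y) ε 0<ε = go (bounded (cauchy y))
  where
  go : (∃ λ B → 0ℚ < B × ∃ λ M → ∀ n → M ℕ.≤ n → ∣ seq y n ∣ ≤ B) →
       ∃ λ L → ∀ n → L ℕ.≤ n → 0ℚ ≤ seq x n * seq y n + ε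
  go (B , 0<B , M , y≤B) = N ℕ.⊔ (M ℕ.⊔ K) , λ n n≥ →
    let n≥′ = ℕ.m⊔n≤o⇒n≤o N (M ℕ.⊔ K) n≥
    in 0≤w*y+ε {seq x n} {seq y n} {η} {ε}
      (0≤y n (ℕ.m⊔n≤o⇒m≤o N (M ℕ.⊔ K) n≥))
      (proj₂ x+η≥0 n (ℕ.m⊔n≤o⇒n≤o M K n≥′))
      (proj₂ (proj₂ δ) (seq y n) η (y≤B n (ℕ.m⊔n≤o⇒m≤o M K n≥′))
        (subst (_< proj₁ δ) (sym (ℚ.0≤p⇒∣p∣≡p (ℚ.<⇒≤ 0<η))) η<δ))
    where
    δ = scale 0<B 0<ε
    -- `scale` controls only errors strictly below its `δ`, so a smaller positive `η` is taken.
    between = ℚ.<-dense (proj₁ (proj₂ δ))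
    η = proj₁ between
    0<η = proj₁ (proj₂ between)
    η<δ = proj₂ (proj₂ between)
    x+η≥0 = 0≤x η 0<η
    K = proj₁ x+η≥0

-- A threshold strictly between 0 and ½: the negated sum of weighted excesses is eventually at most
-- ¼, yet tends to ½.
¼ : ℚ
¼ = ½ * ½

-- Subtracting ½ from u·p leaves terms that are still nonnegative from some index on when `p`
-- represents a point where `u` is positive.
excess : ℤ² → ℝ² → ℝ
excess (u , v) (x , y) = fromℤ u *ᵣ x +ᵣ fromℤ v *ᵣ y +ᵣ fromℚ (- ½)

-- Linearity reduces the sum to the three sums whose limits a convex combination prescribes.
Σᵣ-excess : ∀ u {k} (w : Fin k → ℝ) (p : Fin k → ℝ²) n →
  seq (Σᵣ (λ i → w i *ᵣ excess u (p i))) n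
  ≡ proj₁ u / 1 * seq (Σᵣ (λ i → w i *ᵣ proj₁ (p i))) n
    + proj₂ u / 1 * seq (Σᵣ (λ i → w i *ᵣ proj₂ (p i))) n
    + - ½ * seq (Σᵣ w) n
Σᵣ-excess u {zero}  w p n = sym (eq (proj₁ u / 1) (proj₂ u / 1))
  where
  open ℚ-Solver.+-*-Solver
  eq : ∀ r s → r * 0ℚ + s * 0ℚ + - ½ * 0ℚ ≡ 0ℚ
  eq = solve 2 (λ r s → r :* con 0ℚ :+ s :* con 0ℚ :+ :- con ½ :* con 0ℚ := con 0ℚ) refl
Σᵣ-excess u {suc k} w p n = trans
  (cong (λ t → seq (w zero *ᵣ excess u (p zero)) n + t) (Σᵣ-excess u (w ∘ suc) (p ∘ suc) n))
  (eq (seq (w zero) n) (seq (proj₁ (p zero)) n) (seq (proj₂ (p zero)) n)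
    (proj₁ u / 1) (proj₂ u / 1) (- ½)
    (seq (Σᵣ (λ i → w (suc i) *ᵣ proj₁ (p (suc i)))) n)
    (seq (Σᵣ (λ i → w (suc i) *ᵣ proj₂ (p (suc i)))) n)
    (seq (Σᵣ (w ∘ suc)) n))
  where
  open ℚ-Solver.+-*-Solver
  eq : ∀ w x y r s h X Y W → w * (r * x + s * y + h) + (r * X + s * Y + h * W)
       ≡ r * (w * x + X) + s * (w * y + Y) + h * (w + W)
  eq = solve 9 (λ w x y r s h X Y W →
    w :* (r :* x :+ s :* y :+ h) :+ (r :* X :+ s :* Y :+ h :* W)
    := r :* (w :* x :+ X) :+ s :* (w :* y :+ Y) :+ h :* (w :+ W)) refl

-- If Σ wᵢ pᵢ ≈ 0 and Σ wᵢ ≈ 1, then Σ wᵢ (u·pᵢ − ½) ≈ −½, although all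
-- summands are nonnegative.
positive⇒0∉Conv : ∀ {S : Pred ℤ² ℓ} u → (∀ {A} → A ∈ S → 0ℤ ℤ.< dot u A) → 0² ∉ Conv ι[ S ]
positive⇒0∉Conv u u>0 (k , w , p , p∈S , 0≤w , Σw≈1 , Σwx≈0 , Σwy≈0) =
  ℚ.<-irrefl refl (ℚ.<-≤-trans (proj₂ lower n (ℕ.m≤n⊔m N M)) (begin
    - 1ℚ * (r * seq Σwx n + s * seq Σwy n + - ½ * seq (Σᵣ w) n)  ≡⟨ cong (- 1ℚ *_) (sym (Σᵣ-excess u w p n)) ⟩
    - 1ℚ * seq Σwe n                                               ≤⟨ negate (seq Σwe n) (proj₂ upper n (ℕ.m≤m⊔n N M)) ⟩
    ¼                                                              ∎))
  where
  open ℚ.≤-Reasoning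
  r s : ℚ
  r = proj₁ u / 1
  s = proj₂ u / 1
  Σwx Σwy Σwe : ℝ
  Σwx = Σᵣ (λ i → w i *ᵣ proj₁ (p i))
  Σwy = Σᵣ (λ i → w i *ᵣ proj₂ (p i))
  Σwe = Σᵣ (λ i → w i *ᵣ excess u (p i))
  excess≥0 : ∀ i → ∃ λ N → ∀ n → N ℕ.≤ n → 0ℚ ≤ seq (excess u (p i)) n
  excess≥0 i = proj₁ eventually , λ n n≥ → ℚ.+-monoˡ-≤ (- ½) (proj₂ eventually n n≥)
    where
    A = proj₁ (p∈S i)
    eventually = positive⇒eventually≥½ u {A} {p i} (u>0 (proj₁ (proj₂ (p∈S i)))) (proj₂ (proj₂ (p∈S i)))
  limit : ∀ r s → - 1ℚ * (r * 0ℚ + s * 0ℚ + - ½ * 1ℚ) ≡ ½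
  limit = solve 2 (λ r s →
    :- con 1ℚ :* (r :* con 0ℚ :+ s :* con 0ℚ :+ :- con ½ :* con 1ℚ) := con ½) refl
    where open ℚ-Solver.+-*-Solver
  upper : ∃ λ N → ∀ n → N ℕ.≤ n → 0ℚ ≤ seq Σwe n + ¼
  upper = 0≤ᵣ-Σᵣ (λ i → w i *ᵣ excess u (p i))
    (λ i → 0≤ᵣ-* (w i) (excess u (p i)) (0≤w i) (excess≥0 i)) ¼ (ℚ.positive⁻¹ ¼)
  lower : ∃ λ M → ∀ n → M ℕ.≤ n → ¼ < - 1ℚ * (r * seq Σwx n + s * seq Σwy n + - ½ * seq (Σᵣ w) n)
  lower = ⟶⇒eventually> _ (- 1ℚ * (r * 0ℚ + s * 0ℚ + - ½ * 1ℚ)) ¼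
    (⟶-scale (- 1ℚ) (λ n → r * seq Σwx n + s * seq Σwy n + - ½ * seq (Σᵣ w) n) (r * 0ℚ + s * 0ℚ + - ½ * 1ℚ)
      (⟶-+ (λ n → r * seq Σwx n + s * seq Σwy n) (λ n → - ½ * seq (Σᵣ w) n) (r * 0ℚ + s * 0ℚ) (- ½ * 1ℚ)
        (⟶-+ (λ n → r * seq Σwx n) (λ n → s * seq Σwy n) (r * 0ℚ) (s * 0ℚ)
          (⟶-scale r (seq Σwx) 0ℚ Σwx≈0) (⟶-scale s (seq Σwy) 0ℚ Σwy≈0))
        (⟶-scale (- ½) (seq (Σᵣ w)) 1ℚ Σw≈1)))
    (subst (¼ <_) (sym (limit r s)) (ℚ.*<* (ℤ.+<+ (s≤s (s≤s (s≤s z≤n))))))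
  N M n : ℕ
  N = proj₁ upper
  M = proj₁ lower
  n = N ℕ.⊔ M
  negate : ∀ t → 0ℚ ≤ t + ¼ → - 1ℚ * t ≤ ¼
  negate t 0≤t+¼ =
    subst₂ _≤_ (ℚ.+-identityʳ (- 1ℚ * t)) (eq t ¼) (ℚ.+-monoʳ-≤ (- 1ℚ * t) 0≤t+¼)
    where
    open ℚ-Solver.+-*-Solver
    eq : ∀ t q → - 1ℚ * t + (t + q) ≡ q
    eq = solve 2 (λ t q → :- con 1ℚ :* t :+ (t :+ q) := q) refl

-- The origin as a convex combination with uniform weights.

suc-/1 : ∀ k → + suc k / 1 ≡ 1ℚ + + k / 1
suc-/1 k = /1-homo-+ 1ℤ (+ k)

Σᵣ-replicate : ∀ k q n → seq (Σᵣ {k} (λ _ → fromℚ q)) n ≡ + k / 1 * q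
Σᵣ-replicate zero    q n = sym (ℚ.*-zeroˡ q)
Σᵣ-replicate (suc k) q n = begin
  q + seq (Σᵣ {k} (λ _ → fromℚ q)) n  ≡⟨ cong (λ t → q + t) (Σᵣ-replicate k q n) ⟩
  q + + k / 1 * q                     ≡⟨ eq (+ k / 1) q ⟩
  (1ℚ + + k / 1) * q                  ≡⟨ cong (_* q) (suc-/1 k) ⟨
  + suc k / 1 * q                     ∎
  where
  open ≡-Reasoning
  eq : ∀ k q → q + k * q ≡ (1ℚ + k) * q
  eq = solve 2 (λ k q → q :+ k :* q := (con 1ℚ :+ k) :* q) refl
    where open ℚ-Solver.+-*-Solver

seq-Σᵣ : ∀ {k} (f : Fin k → ℝ) n → seq (Σᵣ f) n ≡ sum (λ i → seq (f i) n)
seq-Σᵣ {zero}  f n = refl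
seq-Σᵣ {suc k} f n = cong (λ t → seq (f zero) n + t) (seq-Σᵣ (f ∘ suc) n)

-- An arbitrary additive `π` stands for either coordinate projection.
sum-coordinate : ∀ (π : ℤ² → ℤ) → (∀ A B → π (A ⊕ B) ≡ π A ℤ.+ π B) → π O ≡ 0ℤ → ∀ q As →
  sum (λ i → q * (π (lookup As i) / 1)) ≡ q * (π (α As) / 1)
sum-coordinate π homo πO≡0 q []       = sym (trans (cong (λ i → q * (i / 1)) πO≡0) (ℚ.*-zeroʳ q))
sum-coordinate π homo πO≡0 q (A ∷ As) = begin
  q * (π A / 1) + sum (λ i → q * (π (lookup As i) / 1))
    ≡⟨ cong (λ t → q * (π A / 1) + t) (sum-coordinate π homo πO≡0 q As) ⟩
  q * (π A / 1) + q * (π (α As) / 1)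
    ≡⟨ ℚ.*-distribˡ-+ q (π A / 1) (π (α As) / 1) ⟨
  q * (π A / 1 + π (α As) / 1)
    ≡⟨ cong (λ t → q * t) (/1-homo-+ (π A) (π (α As))) ⟨
  q * ((π A ℤ.+ π (α As)) / 1)
    ≡⟨ cong (λ i → q * (i / 1)) (homo A (α As)) ⟨
  q * (π (α (A ∷ As)) / 1)
    ∎
  where open ≡-Reasoning

vanishing⇒0∈Conv : ∀ {S : Pred ℤ² ℓ} {As} → (∀ {A} → A ∈ₗ As → A ∈ S) → VanishingSum As → 0² ∈ Conv ι[ S ]
vanishing⇒0∈Conv {S = S} As⊆S (B , Bs , B∷Bs⊆As , sum≡O) =
  k , w , p , p∈S , 0≤w , constant-⟶ (seq (Σᵣ w)) 1ℚ Σw≡1 ,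
  constant-⟶ (seq (Σᵣ (λ i → w i *ᵣ proj₁ (p i)))) 0ℚ
    (coordinate≡0 proj₁ (λ _ _ → refl) refl (λ i → w i *ᵣ proj₁ (p i)) (λ _ _ → refl)) ,
  constant-⟶ (seq (Σᵣ (λ i → w i *ᵣ proj₂ (p i)))) 0ℚ
    (coordinate≡0 proj₂ (λ _ _ → refl) refl (λ i → w i *ᵣ proj₂ (p i)) (λ _ _ → refl))
  where
  k : ℕ
  k = suc (length Bs)
  instance
    k-pos : ℚ.Positive (+ k / 1)
    k-pos = ℚ.positive (ℚ.<-≤-trans (ℚ.positive⁻¹ 1ℚ) (0<i⇒1≤i/1 {+ k} (ℤ.+<+ ℕ.z<s)))
    k-nonZero : ℚ.NonZero (+ k / 1)
    k-nonZero = ℚ.pos⇒nonZero (+ k / 1)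
  q : ℚ
  q = ℚ.1/ (+ k / 1)
  0≤q : 0ℚ ≤ q
  0≤q = ℚ.<⇒≤ (ℚ.positive⁻¹ q {{ℚ.1/pos⇒pos (+ k / 1)}})
  w : Fin k → ℝ
  w _ = fromℚ q
  p : Fin k → ℝ²
  p i = ι (lookup (B ∷ Bs) i)
  p∈S : ∀ i → p i ∈ ι[ S ]
  p∈S i = lookup (B ∷ Bs) i , As⊆S (All.lookup B∷Bs⊆As (∈-lookup i)) , ≈²-refl {p i}
  0≤w : ∀ i → 0ᵣ ≤ᵣ w i
  0≤w _ ε 0<ε = 0 , λ _ _ → ℚ.+-mono-≤ 0≤q (ℚ.<⇒≤ 0<ε)
  Σw≡1 : ∀ n → seq (Σᵣ w) n ≡ 1ℚ
  Σw≡1 n = trans (Σᵣ-replicate k q n) (ℚ.*-inverseʳ (+ k / 1))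
  coordinate≡0 : ∀ (π : ℤ² → ℤ) → (∀ A B → π (A ⊕ B) ≡ π A ℤ.+ π B) → π O ≡ 0ℤ →
    ∀ (f : Fin k → ℝ) → (∀ i n → seq (f i) n ≡ q * (π (lookup (B ∷ Bs) i) / 1)) → ∀ n → seq (Σᵣ f) n ≡ 0ℚ
  coordinate≡0 π homo πO≡0 f f≡ n = begin
    seq (Σᵣ f) n                                ≡⟨ seq-Σᵣ f n ⟩
    sum (λ i → seq (f i) n)                      ≡⟨ sum-cong-≗ (λ i → f≡ i n) ⟩
    sum (λ i → q * (π (lookup (B ∷ Bs) i) / 1))  ≡⟨ sum-coordinate π homo πO≡0 q (B ∷ Bs) ⟩
    q * (π (α (B ∷ Bs)) / 1)                    ≡⟨ cong (λ A → q * (π A / 1)) sum≡O ⟩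
    q * (π O / 1)                               ≡⟨ cong (λ i → q * (i / 1)) πO≡0 ⟩
    q * 0ℚ                                      ≡⟨ ℚ.*-zeroʳ q ⟩
    0ℚ                                          ∎
    where open ≡-Reasoning

-- Vanishing sums and open half-planes.

OpenHalfPlane-⊕ : ∀ u {A B} → ι A ∈ OpenHalfPlane u → ι B ∈ OpenHalfPlane u → ι (A ⊕ B) ∈ OpenHalfPlane u
OpenHalfPlane-⊕ (u , v) {x , y} {x′ , y′} (ε , 0<ε , N , f) (δ , 0<δ , M , g) =
  ε + δ , ℚ.+-mono-< 0<ε 0<δ , N ℕ.⊔ M , λ n n≥ →
    subst₂ _≤_ (eq₁ ε δ)
      (trans (eq₂ (seq u n) (seq v n) (x / 1) (y / 1) (x′ / 1) (y′ / 1))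
        (cong₂ (λ a b → seq u n * a + seq v n * b) (sym (/1-homo-+ x x′)) (sym (/1-homo-+ y y′))))
      (ℚ.+-mono-≤ (f n (ℕ.m⊔n≤o⇒m≤o N M n≥)) (g n (ℕ.m⊔n≤o⇒n≤o N M n≥)))
  where
  open ℚ-Solver.+-*-Solver
  eq₁ : ∀ ε δ → (0ℚ + ε) + (0ℚ + δ) ≡ 0ℚ + (ε + δ)
  eq₁ = solve 2 (λ ε δ → (con 0ℚ :+ ε) :+ (con 0ℚ :+ δ) := con 0ℚ :+ (ε :+ δ)) refl
  eq₂ : ∀ u v x y x′ y′ → (u * x + v * y) + (u * x′ + v * y′) ≡ u * (x + x′) + v * (y + y′)
  eq₂ = solve 6 (λ u v x y x′ y′ → (u :* x :+ v :* y) :+ (u :* x′ :+ v :* y′) := u :* (x :+ x′) :+ v :* (y :+ y′)) refl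

-- The induction starts at one-letter words, as the empty sum `O` lies in no open half-plane.
OpenHalfPlane-α : ∀ u {B Bs} → All (λ A → ι A ∈ OpenHalfPlane u) (B ∷ Bs) → ι (α (B ∷ Bs)) ∈ OpenHalfPlane u
OpenHalfPlane-α u {B} (B>0 ∷ [])            = subst (λ A → ι A ∈ OpenHalfPlane u) (sym (⊕-identityʳ B)) B>0
OpenHalfPlane-α u {B} {B′ ∷ Bs} (B>0 ∷ Bs>0@(_ ∷ _)) = OpenHalfPlane-⊕ u {B} {α (B′ ∷ Bs)} B>0 (OpenHalfPlane-α u Bs>0)

O∉OpenHalfPlane : ∀ u → ι O ∉ OpenHalfPlane u
O∉OpenHalfPlane (u , v) (ε , 0<ε , N , f) = ℚ.<-irrefl refl (ℚ.<-≤-trans 0<ε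
  (subst₂ _≤_ (ℚ.+-identityˡ ε) (cong₂ _+_ (ℚ.*-zeroʳ (seq u N)) (ℚ.*-zeroʳ (seq v N))) (f N ℕ.≤-refl)))

vanishing⇒¬LC : ∀ {S : Pred ℤ² ℓ} {As} → (∀ {A} → A ∈ₗ As → A ∈ S) → VanishingSum As → ¬ LC S
vanishing⇒¬LC As⊆S (B , Bs , B∷Bs⊆As , sum≡O) (u , _ , S>0) = O∉OpenHalfPlane u
  (subst (λ A → ι A ∈ OpenHalfPlane u) sum≡O
    (OpenHalfPlane-α u (All.map (λ {A} A∈ → S>0 {ι A} (A , As⊆S A∈ , ≈²-refl {ι A})) B∷Bs⊆As)))

-- The equivalences.

theorem3p13 : ∀ {a c : Level} (X : Pred ℤ² a) (C : Pred ℤ² c) →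
    O ∉ X → IsSubmonoid C →
    let Y = Admissible X C in
    Finite Y →
    (FPP X C ⇔ 0² ∉ Conv ι[ Y ]) × (0² ∉ Conv ι[ Y ] ⇔ LC Y)
theorem3p13 X C _ submonoid (As , Y⇔As) = [ positive , vanishing ]′ (alternative As)
  where
  Y : Pred ℤ² _
  Y = Admissible X C
  -- This inclusion carries positivity from the list to all admissible steps; the converse makes the
  -- terms of a vanishing sum admissible.
  Y⊆As : ∀ {A} → A ∈ Y → A ∈ₗ As
  Y⊆As {A} = Equivalence.to (Y⇔As A)
  As⊆Y : ∀ {A} → A ∈ₗ As → A ∈ Y
  As⊆Y {A} = Equivalence.from (Y⇔As A)
  Equivalences = (FPP X C ⇔ 0² ∉ Conv ι[ Y ]) × (0² ∉ Conv ι[ Y ] ⇔ LC Y)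

  positive : (∃ λ u → ¬ (u ≡ O) × PositiveOn u As) → Equivalences
  positive (u , u≢O , u>0) = mk⇔ (λ _ → 0∉Conv) (λ _ → fpp) , mk⇔ (λ _ → lc) (λ _ → 0∉Conv)
    where
    Y>0 : ∀ {A} → A ∈ Y → 0ℤ ℤ.< dot u A
    Y>0 A∈Y = All.lookup u>0 (Y⊆As A∈Y)
    0∉Conv : 0² ∉ Conv ι[ Y ]
    0∉Conv = positive⇒0∉Conv {S = Y} u Y>0
    fpp : FPP X C
    fpp = positive⇒FPP {X = X} {C = C} u u>0 Y⊆As
    lc : LC Y
    lc = positive⇒LC {S = Y} u u≢O Y>0

  vanishing : VanishingSum As → Equivalences
  vanishing sum≡O = mk⇔ (⊥-elim ∘ ¬fpp) (λ 0∉Conv → ⊥-elim (0∉Conv 0∈Conv))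
                , mk⇔ (λ 0∉Conv → ⊥-elim (0∉Conv 0∈Conv)) (⊥-elim ∘ ¬lc)
    where
    0∈Conv : 0² ∈ Conv ι[ Y ]
    0∈Conv = vanishing⇒0∈Conv {S = Y} As⊆Y sum≡O
    ¬fpp : ¬ FPP X C
    ¬fpp = vanishing⇒¬FPP {C = C} {X = X} submonoid sum≡O As⊆Y
    ¬lc : ¬ LC Y
    ¬lc = vanishing⇒¬LC {S = Y} As⊆Y sum≡O
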